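{- Let $A$ be a commutative ring and let $X_\bullet$ be any simplicial $A$-module. For every degree $p\ge1$ and every $j\in\{0,\dots,p\}$, $$R_{p,j}(X)\cap D_p(X)=\{0\}.$$
   Context: For a simplicial $A$-module $X_\bullet$ with face maps $d_i:X_p\to X_{p-1}$ and degeneracy maps $s_r:X_{p-1}\to X_p$: the horn kernel is $R_{p,j}(X)=\bigcap_{0\le i\le p,\ i\ne j}\ker(d_i:X_p\to X_{p-1})$, and the degenerate submodule is $D_p(X)=\sum_{r=0}^{p-1}\operatorname{im}(s_r:X_{p-1}\to X_p)$. -}

module Defs where

open import Algebra.Bundles using (CommutativeRing)
open import Algebra.Module.Bundles using (Module)
open import Algebra.Module.Morphism.Structures using (IsModuleHomomorphism)
import Algebra.Definitions.RawMonoid as RawMonoidDefs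
open import Data.Fin.Base using (Fin; suc; inject₁; _≤_)
open import Data.Nat.Base using (ℕ; suc)
open import Data.Product.Base using (Σ-syntax; ∃-syntax; _×_)
open import Level using (Level; _⊔_) renaming (suc to lsuc)
open import Relation.Binary.PropositionalEquality using (_≢_)
open import Relation.Unary using (Pred; _∈_)

private
  variable
    r ℓr m ℓm ℓ : Level

module _ {A : CommutativeRing r ℓr} where

  module _ (M : Module A m ℓm) where
    open Module M

    Zero : Pred Carrierᴹ ℓm
    Zero x = x ≈ᴹ 0ᴹ

    SumOf : ∀ {k} → (Fin k → Pred Carrierᴹ ℓ) → Pred Carrierᴹ (m ⊔ ℓm ⊔ ℓ)
    SumOf {k = k} P x =
      Σ[ y ∈ (Fin k → Carrierᴹ) ] (∀ i → y i ∈ P i) × x ≈ᴹ sum y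
      where open RawMonoidDefs +ᴹ-rawMonoid using (sum)

  module _ (M N : Module A m ℓm) where
    private
      module M = Module M
      module N = Module N

    Ker : (M.Carrierᴹ → N.Carrierᴹ) → Pred M.Carrierᴹ ℓm
    Ker f x = f x N.≈ᴹ N.0ᴹ

    Im : (M.Carrierᴹ → N.Carrierᴹ) → Pred N.Carrierᴹ (m ⊔ ℓm)
    Im f y = ∃[ x ] f x N.≈ᴹ y

-- The simplicial identities are indexed so that every subscript lies in the
-- right Fin: a strict inequality i < j between subscripts is written as i ≤ j′
-- with j = suc j′, and inject₁ leaves the numerical value unchanged.
record SimplicialModule (A : CommutativeRing r ℓr) (m ℓm : Level)
       : Set (r ⊔ ℓr ⊔ lsuc (m ⊔ ℓm)) where
  field
    X : ℕ → Module A m ℓm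

  module X n = Module (X n)

  field
    d : ∀ {n} → Fin (suc (suc n)) → X.Carrierᴹ (suc n) → X.Carrierᴹ n
    s : ∀ {n} → Fin (suc n) → X.Carrierᴹ n → X.Carrierᴹ (suc n)

    d-homo : ∀ {n} (i : Fin (suc (suc n))) →
             IsModuleHomomorphism (X.rawModule (suc n)) (X.rawModule n) (d i)
    s-homo : ∀ {n} (i : Fin (suc n)) →
             IsModuleHomomorphism (X.rawModule n) (X.rawModule (suc n)) (s i)

    -- dᵢ dⱼ = dⱼ₋₁ dᵢ for i < j
    d-d : ∀ {n} (i j : Fin (suc (suc n))) → i ≤ j → ∀ x →
          X._≈ᴹ_ n (d i (d (suc j) x)) (d j (d (inject₁ i) x))

    -- dᵢ sⱼ = sⱼ₋₁ dᵢ for i < j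
    d-s-< : ∀ {n} (i j : Fin (suc n)) → i ≤ j → ∀ x →
            X._≈ᴹ_ (suc n) (d (inject₁ (inject₁ i)) (s (suc j) x))
                           (s j (d (inject₁ i) x))

    -- dⱼ sⱼ = id = dⱼ₊₁ sⱼ
    d-s-≡   : ∀ {n} (j : Fin (suc n)) x → X._≈ᴹ_ n (d (inject₁ j) (s j x)) x
    d-s-suc : ∀ {n} (j : Fin (suc n)) x → X._≈ᴹ_ n (d (suc j) (s j x)) x

    -- dᵢ sⱼ = sⱼ dᵢ₋₁ for i > j + 1
    d-s-> : ∀ {n} (i j : Fin (suc n)) → j ≤ i → ∀ x →
            X._≈ᴹ_ (suc n) (d (suc (suc i)) (s (inject₁ j) x))
                           (s j (d (suc i) x))

    -- sᵢ sⱼ = sⱼ₊₁ sᵢ for i ≤ j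
    s-s : ∀ {n} (i j : Fin (suc n)) → i ≤ j → ∀ x →
          X._≈ᴹ_ (suc (suc n)) (s (inject₁ i) (s j x)) (s (suc j) (s i x))

-- Degrees p ≥ 1 are written p = suc n.
module _ {A : CommutativeRing r ℓr} (S : SimplicialModule A m ℓm) where
  open SimplicialModule S

  HornKernel : ∀ n → Fin (suc (suc n)) → Pred (X.Carrierᴹ (suc n)) ℓm
  HornKernel n j x = ∀ i → i ≢ j → x ∈ Ker (X (suc n)) (X n) (d i)

  Degenerate : ∀ n → Pred (X.Carrierᴹ (suc n)) (m ⊔ ℓm)
  Degenerate n = SumOf (X (suc n)) {k = suc n} λ i → Im (X n) (X (suc n)) (s i)

{-# OPTIONS --safe #-}
-- If x lies in the horn kernel, then x = (1 - s_r d_i) x for every i ≠ j, while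
-- 1 - s_r d_i annihilates im s_r for i ∈ {r, r + 1}.  For i = r this operator maps
-- im s_k into itself for all k > r, for i = r + 1 for all k < r.  So in x = Σ_k s_k y_k
-- the terms k < j are removed in increasing order using i = k, and the remaining ones
-- in decreasing order using i = k + 1; the face d_j is never used.
module Submission where

open import Defs
open import Algebra.Bundles using (CommutativeRing)
open import Algebra.Module.Bundles using (Module)
import Algebra.Definitions.RawMonoid as RawMonoidDefs
import Algebra.Module.Morphism.Construct.Composition as Composition
open import Algebra.Module.Morphism.Structures using (IsModuleHomomorphism)
import Algebra.Properties.AbelianGroup as AbelianGroupProperties
import Algebra.Properties.CommutativeMonoid.Sum as SumProperties
open import Data.Empty using (⊥-elim)
open import Data.Fin.Base using (Fin; suc; toℕ; fromℕ<; inject₁; _<_)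
open import Data.Fin.Properties
  using (_≟_; toℕ≤pred[n]; toℕ<n; toℕ-fromℕ<; toℕ-inject₁; toℕ-injective; ≤fromℕ)
open import Data.Fin.Relation.Unary.Top using (view; ‵fromℕ; ‵inject₁)
open import Data.Nat.Base as ℕ using (ℕ; zero; suc; z≤n; s≤s⁻¹)
import Data.Nat.Properties as ℕ
open import Data.Product.Base using (∃-syntax; _×_; _,_)
open import Data.Sum.Base using (_⊎_; inj₁; inj₂)
open import Function.Base using (_∘_)
open import Level using (Level; 0ℓ; _⊔_)
open import Relation.Binary.PropositionalEquality
  using (_≢_; refl; sym; trans; cong; subst)
import Relation.Binary.Reasoning.Setoid as SetoidReasoning
open import Relation.Nullary using (yes; no)
open import Relation.Unary using (Pred; _∈_; _∉_; _∩_; _≐_)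

private
  variable
    r ℓr m ℓm ℓ ℓ′ : Level

module _ {A : CommutativeRing r ℓr} where

  module _ (M N : Module A m ℓm) where
    private
      module M = Module M
      module N = Module N

    sum-homo : ∀ {f} → IsModuleHomomorphism M.rawModule N.rawModule f →
               ∀ {k} (y : Fin k → M.Carrierᴹ) →
               f (RawMonoidDefs.sum M.+ᴹ-rawMonoid y) N.≈ᴹ
               RawMonoidDefs.sum N.+ᴹ-rawMonoid (f ∘ y)
    sum-homo f-homo {zero}  y = IsModuleHomomorphism.0ᴹ-homo f-homo
    sum-homo f-homo {suc k} y =
      N.≈ᴹ-trans (IsModuleHomomorphism.+ᴹ-homo f-homo _ _)
                 (N.+ᴹ-cong N.≈ᴹ-refl (sum-homo f-homo (y ∘ suc)))

  module _ (M : Module A m ℓm) where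
    open Module M
    open RawMonoidDefs +ᴹ-rawMonoid using (sum)
    open SumProperties +ᴹ-commutativeMonoid
      using (sum-cong-≋; sum-replicate-zero; ∑-distrib-+)
    open AbelianGroupProperties +ᴹ-abelianGroup using (xyx⁻¹≈y)
    open SetoidReasoning ≈ᴹ-setoid

    sum-zero : ∀ {k} {y : Fin k → Carrierᴹ} → (∀ i → y i ≈ᴹ 0ᴹ) → sum y ≈ᴹ 0ᴹ
    sum-zero {k} y≈0 = ≈ᴹ-trans (sum-cong-≋ y≈0) (sum-replicate-zero k)

    +-cancel-middle : ∀ u v → u +ᴹ (v +ᴹ -ᴹ u) ≈ᴹ v
    +-cancel-middle u v = ≈ᴹ-trans (≈ᴹ-sym (+ᴹ-assoc u v (-ᴹ u))) (xyx⁻¹≈y u v)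

    -- Since `f x` vanishes, x = (1 - f) x, and by additivity 1 - f may be applied to each summand
    -- of x separately.
    SumOf-id-minus : ∀ {k} {P : Fin k → Pred Carrierᴹ ℓ} {Q : Fin k → Pred Carrierᴹ ℓ′} {f} →
                     IsModuleHomomorphism rawModule rawModule f →
                     (∀ i {z} → z ∈ P i → (z +ᴹ -ᴹ f z) ∈ Q i) →
                     ∀ {x} → f x ≈ᴹ 0ᴹ → x ∈ SumOf M P → x ∈ SumOf M Q
    SumOf-id-minus {f = f} f-homo P⇒Q {x} fx≈0 (y , Py , x≈∑y) =
      y′ , (λ i → P⇒Q i (Py i)) , (begin
        x                         ≈⟨ x≈∑y ⟩
        sum y                     ≈⟨ sum-cong-≋ (λ i → +-cancel-middle (f (y i)) (y i)) ⟨
        sum (λ i → f (y i) +ᴹ y′ i) ≈⟨ ∑-distrib-+ (f ∘ y) y′ ⟩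
        sum (f ∘ y) +ᴹ sum y′     ≈⟨ +ᴹ-cong (sum-homo M M f-homo y) ≈ᴹ-refl ⟨
        f (sum y) +ᴹ sum y′       ≈⟨ +ᴹ-cong (⟦⟧-cong x≈∑y) ≈ᴹ-refl ⟨
        f x +ᴹ sum y′             ≈⟨ +ᴹ-cong fx≈0 ≈ᴹ-refl ⟩
        0ᴹ +ᴹ sum y′              ≈⟨ +ᴹ-identityˡ _ ⟩
        sum y′                    ∎)
      where
      open IsModuleHomomorphism f-homo using (⟦⟧-cong)
      y′ = λ i → y i +ᴹ -ᴹ f (y i)

module _ {A : CommutativeRing r ℓr} (S : SimplicialModule A m ℓm) where
  open SimplicialModule S
  private
    module d {n} (i : Fin (suc (suc n))) = IsModuleHomomorphism (d-homo i)
    module s {n} (i : Fin (suc n)) = IsModuleHomomorphism (s-homo i)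

    infix 4 _≈_
    _≈_ : ∀ {n} → X.Carrierᴹ n → X.Carrierᴹ n → Set ℓm
    _≈_ {n} = X._≈ᴹ_ n

  s∘d-homo : ∀ {n} (k : Fin (suc n)) (i : Fin (suc (suc n))) →
             IsModuleHomomorphism (X.rawModule (suc n)) (X.rawModule (suc n)) (s k ∘ d i)
  s∘d-homo {n} k i =
    Composition.isModuleHomomorphism (X.≈ᴹ-trans (suc n)) (d-homo i) (s-homo k)

  -- For k < l the simplicial identities give s_k d_k s_l = s_k s_{l-1} d_k = s_l s_k d_k.
  s-d-inject₁-s : ∀ {n} {k l : Fin (suc n)} → k < l → ∀ y →
                  ∃[ w ] s k (d (inject₁ k) (s l y)) ≈ s l w
  -- As k < l, k is not the top index, so it is an `inject₁`, the form in which `d-s-<` and `s-s`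
  -- apply.
  s-d-inject₁-s {suc n} {k} {suc l} k<l y with view k
  ... | ‵fromℕ     = ⊥-elim (ℕ.<⇒≱ k<l (≤fromℕ (suc l)))
  ... | ‵inject₁ k = _ , X.≈ᴹ-trans _ (s.⟦⟧-cong _ (d-s-< k l k≤l y)) (s-s k l k≤l _)
    where k≤l = subst (ℕ._≤ toℕ l) (toℕ-inject₁ k) (s≤s⁻¹ k<l)

  -- The mirror case: for l < k, s_k d_{k+1} s_l = s_k s_l d_k = s_l s_{k-1} d_k.
  s-d-suc-s : ∀ {n} {k l : Fin (suc n)} → l < k → ∀ y →
              ∃[ w ] s k (d (suc k) (s l y)) ≈ s l w
  s-d-suc-s {suc n} {suc k} {l} l<k y with view l
  ... | ‵fromℕ     = ⊥-elim (ℕ.<⇒≱ l<k (≤fromℕ (suc k)))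
  ... | ‵inject₁ l = _ , X.≈ᴹ-trans _ (s.⟦⟧-cong _ (d-s-> k l l≤k y))
                                    (X.≈ᴹ-sym _ (s-s l k l≤k _))
    where l≤k = subst (ℕ._≤ toℕ k) (toℕ-inject₁ l) (s≤s⁻¹ l<k)

  module _ {n : ℕ} where
    open Module (X (suc n))
    open AbelianGroupProperties +ᴹ-abelianGroup using (ε⁻¹≈ε)

    -- A removed term stays in the sum as a zero, so every sum runs over the same index set and none
    -- is reindexed.
    SupportedTerm : Pred (Fin (suc n)) 0ℓ → Fin (suc n) → Pred Carrierᴹ (m ⊔ ℓm)
    SupportedTerm T k z = z ≈ᴹ 0ᴹ ⊎ (k ∈ T × z ∈ Im (X n) (X (suc n)) (s k))

    DegenerateOn : Pred (Fin (suc n)) 0ℓ → Pred Carrierᴹ (m ⊔ ℓm)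
    DegenerateOn T = SumOf (X (suc n)) (SupportedTerm T)

    DegenerateOn-∅ : ∀ {T} → (∀ k → k ∉ T) → ∀ {x} → x ∈ DegenerateOn T → x ≈ᴹ 0ᴹ
    DegenerateOn-∅ {T} T-empty (y , Ty , x≈∑y) =
      ≈ᴹ-trans x≈∑y (sum-zero (X (suc n)) λ k → vanish k (Ty k))
      where
      vanish : ∀ k {z} → z ∈ SupportedTerm T k → z ≈ᴹ 0ᴹ
      vanish k (inj₁ z≈0)       = z≈0
      vanish k (inj₂ (k∈T , _)) = ⊥-elim (T-empty k k∈T)

    -- One application of 1 - s_k d_i, which fixes x because d_i x = 0. It kills im s_k, and by the
    -- last hypothesis on l it keeps each other summand in its own im s_l.
    remove : ∀ k i → (∀ y → d i (s k y) ≈ y) → ∀ {T T′} →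
             (∀ l → l ∈ T → l ≢ k → l ∈ T′ × ∀ y → ∃[ w ] s k (d i (s l y)) ≈ s l w) →
             ∀ {x} → x ∈ Ker (X (suc n)) (X n) (d i) →
             x ∈ DegenerateOn T → x ∈ DegenerateOn T′
    remove k i d-s {T} {T′} step dx≈0 =
      SumOf-id-minus (X (suc n)) {P = SupportedTerm T} {Q = SupportedTerm T′} (s∘d-homo k i) shrink
        (≈ᴹ-trans (s.⟦⟧-cong k dx≈0) (s.0ᴹ-homo k))
      where
      module f = IsModuleHomomorphism (s∘d-homo k i)

      shrink : ∀ l {z} → z ∈ SupportedTerm T l → (z +ᴹ -ᴹ s k (d i z)) ∈ SupportedTerm T′ l
      shrink l (inj₁ z≈0) = inj₁ (≈ᴹ-trans
        (+ᴹ-cong z≈0 (≈ᴹ-trans (-ᴹ‿cong (≈ᴹ-trans (f.⟦⟧-cong z≈0) f.0ᴹ-homo)) ε⁻¹≈ε))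
        (+ᴹ-identityˡ 0ᴹ))
      shrink l {z} (inj₂ (l∈T , y , sy≈z)) with l ≟ k
      ... | yes refl = inj₁ (≈ᴹ-trans (+ᴹ-cong ≈ᴹ-refl (-ᴹ‿cong sdz≈z)) (-ᴹ‿inverseʳ z))
        where
        sdz≈z : s k (d i z) ≈ᴹ z
        sdz≈z = ≈ᴹ-trans (f.⟦⟧-cong (≈ᴹ-sym sy≈z)) (≈ᴹ-trans (s.⟦⟧-cong k (d-s y)) sy≈z)
      ... | no l≢k with step l l∈T l≢k
      ...   | l∈T′ , sds with sds y
      -- With z = s_l y and s_k d_i z = s_l w, the new summand is s_l (y - w).
      ...     | w , sdsy≈sw = inj₂ (l∈T′ , X._+ᴹ_ n y (X.-ᴹ_ n w) , ≈ᴹ-trans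
        (s.+ᴹ-homo l _ _)
        (+ᴹ-cong sy≈z (≈ᴹ-trans (s.-ᴹ-homo l w)
          (-ᴹ‿cong (≈ᴹ-trans (≈ᴹ-sym sdsy≈sw) (f.⟦⟧-cong sy≈z))))))

    module _ {j : Fin (suc (suc n))} {x : Carrierᴹ} (x∈R : x ∈ HornKernel S n j) where

      -- Step a uses the face d_a, which kills x because a < j. All indices below a are gone by
      -- then, so the surviving l satisfy l > a, as `s-d-inject₁-s` requires.
      remove-below : x ∈ Degenerate S n → ∀ a → a ℕ.≤ toℕ j →
                     x ∈ DegenerateOn (λ k → a ℕ.≤ toℕ k)
      remove-below (y , sy , x≈∑y) zero    a≤j = y , (λ k → inj₂ (z≤n , sy k)) , x≈∑y
      remove-below x∈D             (suc a) a<j =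
        remove k (inject₁ k) (d-s-≡ k) step (x∈R (inject₁ k) k≢j)
          (remove-below x∈D a (ℕ.<⇒≤ a<j))
        where
        -- There is one more face than degeneracy: a < j ≤ n + 1 makes a a valid index of a
        -- degeneracy.
        a<1+n = ℕ.<-≤-trans a<j (toℕ≤pred[n] j)
        k     = fromℕ< a<1+n
        k≡a   = toℕ-fromℕ< a<1+n
        k≢j : inject₁ k ≢ j
        k≢j e = ℕ.<⇒≢ a<j (trans (sym k≡a) (trans (sym (toℕ-inject₁ k)) (cong toℕ e)))
        step : ∀ l → a ℕ.≤ toℕ l → l ≢ k → a ℕ.< toℕ l × _
        step l a≤l l≢k = a<l , s-d-inject₁-s (subst (ℕ._< toℕ l) (sym k≡a) a<l)
          where a<l = ℕ.≤∧≢⇒< a≤l λ e → l≢k (toℕ-injective (sym (trans k≡a e)))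

      -- The support is a window from j up to, but excluding, b. Its largest index k is removed with
      -- the face d_{k+1}, and k + 1 > j since k ≥ j.
      remove-above : ∀ b → b ℕ.≤ suc n →
                     x ∈ DegenerateOn (λ k → toℕ j ℕ.≤ toℕ k × toℕ k ℕ.< b) → x ≈ᴹ 0ᴹ
      remove-above zero    _   = DegenerateOn-∅ λ { _ (_ , ()) }
      remove-above (suc b) b<1+n x∈D with toℕ j ℕ.≤? b
      -- Here b < j and the window is empty; for j = n + 1 this happens at the very start.
      ... | no  j≰b = DegenerateOn-∅
        (λ { k (j≤k , k<1+b) → j≰b (ℕ.≤-trans j≤k (s≤s⁻¹ k<1+b)) }) x∈D
      ... | yes j≤b = remove-above b (ℕ.<⇒≤ b<1+n)
        (remove k (suc k) (d-s-suc k) step (x∈R (suc k) k≢j) x∈D)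
        where
        k   = fromℕ< b<1+n
        k≡b = toℕ-fromℕ< b<1+n
        k≢j : suc k ≢ j
        k≢j e = ℕ.<⇒≱ (ℕ.n<1+n b) (subst (ℕ._≤ b) (trans (cong toℕ (sym e)) (cong suc k≡b)) j≤b)
        step : ∀ l → toℕ j ℕ.≤ toℕ l × toℕ l ℕ.< suc b → l ≢ k →
               (toℕ j ℕ.≤ toℕ l × toℕ l ℕ.< b) × _
        step l (j≤l , l<1+b) l≢k = (j≤l , l<b) , s-d-suc-s (subst (toℕ l ℕ.<_) (sym k≡b) l<b)
          where l<b = ℕ.≤∧≢⇒< (s≤s⁻¹ l<1+b) λ e → l≢k (toℕ-injective (trans e (sym k≡b)))

      horn∩degenerate⇒zero : x ∈ Degenerate S n → x ≈ᴹ 0ᴹ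
      horn∩degenerate⇒zero x∈D with remove-below x∈D (toℕ j) ℕ.≤-refl
      -- Every index is below n + 1, so the support k ≥ j is already the window that ends at n + 1.
      ... | y , Ty , x≈∑y = remove-above (suc n) ℕ.≤-refl (y , (λ k → bound k (Ty k)) , x≈∑y)
        where
        bound : ∀ k {z} → z ∈ SupportedTerm (λ k → toℕ j ℕ.≤ toℕ k) k →
                z ∈ SupportedTerm (λ k → toℕ j ℕ.≤ toℕ k × toℕ k ℕ.< suc n) k
        bound k (inj₁ z≈0)         = inj₁ z≈0
        bound k (inj₂ (j≤k , z∈s)) = inj₂ ((j≤k , toℕ<n k) , z∈s)

    zero⇒horn : ∀ j {x} → x ≈ᴹ 0ᴹ → x ∈ HornKernel S n j
    zero⇒horn j x≈0 i _ = X.≈ᴹ-trans n (d.⟦⟧-cong i x≈0) (d.0ᴹ-homo i)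

    zero⇒degenerate : ∀ {x} → x ≈ᴹ 0ᴹ → x ∈ Degenerate S n
    zero⇒degenerate x≈0 =
      (λ _ → 0ᴹ) , (λ k → X.0ᴹ n , s.0ᴹ-homo k) ,
      ≈ᴹ-trans x≈0 (≈ᴹ-sym (sum-zero (X (suc n)) {suc n} λ _ → ≈ᴹ-refl))

lemma6p1 : {r ℓr m ℓm : Level} (A : CommutativeRing r ℓr) (S : SimplicialModule A m ℓm)
    (n : ℕ) (j : Fin (suc (suc n))) →
    (HornKernel S n j ∩ Degenerate S n) ≐ Zero (SimplicialModule.X S (suc n))
lemma6p1 A S n j =
  (λ (x∈R , x∈D) → horn∩degenerate⇒zero S {j = j} x∈R x∈D) ,
  (λ x≈0 → zero⇒horn S j x≈0 , zero⇒degenerate S x≈0)
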